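{- Let $\Psi$ be the invariant of labeled posets with values in $\mathbb Q[t]$ defined recursively by $\Psi(\emptyset)=1$ and, for every non-empty labeled poset $(P,\omega)$, $$\Psi(P,\omega)=\Delta^{ -1}\sum_{\emptyset\ne S\in\mathcal I_\omega(P)}\Psi(P\setminus S,\omega).$$ Then $\Psi(P,\omega)=\Omega(P,\omega;t)$ for every finite labeled poset $(P,\omega)$.
   Context: All posets are finite and $\mathbb N^+=\{1,2,\dots\}$, $[n]=\{1,\dots,n\}$. An ideal of a poset $P$ is a down-closed subset (including $\emptyset$ and $P$). A labeled poset $(P,\omega)$ is a finite poset $P$ with an injective map $\omega:P\to\mathbb N^+$; each subset $S\subseteq P$ carries the induced order and labeling, giving a labeled poset $(S,\omega)$. A subset $S$ is $\omega$-natural if $\omega|_S$ is order-preserving; $\mathcal I_\omega(P)$ is the set of ideals of $P$ that are $\omega$-natural. A map $f:P\to[n]$ is $\omega$-order-preserving if it is order-preserving and $f(x)>f(y)$ whenever $x>y$ in $P$ and $\omega(x)<\omega(y)$. The order polynomial $\Omega(P,\omega;t)$ is the unique polynomial in $t$ whose value at each $n\in\mathbb N^+$ is the number of $\omega$-order-preserving maps $P\to[n]$; $\Omega(\emptyset,\omega;t)=1$. The operator $\Delta$ on $\mathbb Q[t]$ is $(\Delta f)(t)=f(t+1)-f(t)$, and $\Delta^{ -1}$ is the linear operator on $\mathbb Q[t]$ sending $f$ to the unique polynomial $g$ with $g(0)=0$ and $\Delta g=f$. -}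

module Defs where

open import Data.Bool using (if_then_else_)
open import Data.Fin as Fin using (Fin)
import Data.Fin.Properties as Fin
open import Data.Fin.Subset using (Subset; inside; outside; _∈_; ∁; ∣_∣; Nonempty)
open import Data.Fin.Subset.Properties using (∣∁p∣≡n∸∣p∣; nonempty?; x∈p⇒∣p-x∣<∣p∣; ∣p∣≤n; _∈?_)
open import Data.Integer as ℤ using (+_)
import Data.Integer.Properties as ℤ
open import Data.List using (List; []; _∷_; map; filter; length; foldr; cartesianProductWith; allFin)
open import Data.List.Properties using (map-cong)
open import Data.List.Relation.Unary.All using (All; []; _∷_; toList)
open import Data.List.Relation.Unary.All.Properties using (all-filter)
open import Data.Nat as ℕ using (ℕ; zero; suc; z≤n; s≤s)
open import Data.Nat.Induction using (<-wellFounded)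
import Data.Nat.Properties as ℕ
open import Data.Product using (Σ; ∃; _×_; _,_; proj₁; proj₂)
open import Data.Rational as ℚ using (ℚ; 0ℚ; 1ℚ; _/_; _+_; _*_; _-_; -_)
open import Data.Rational.Properties as ℚ using (toℚᵘ-injective; toℚᵘ-homo-+; toℚᵘ-homo-*; toℚᵘ-fromℚᵘ)
open import Data.Rational.Solver using (module +-*-Solver)
import Data.Rational.Unnormalised as ℚᵘ
import Data.Rational.Unnormalised.Properties as ℚᵘ
open import Data.Vec using (Vec; []; _∷_; lookup; here; there)
open import Data.Vec.Properties.WithK using ([]=-irrelevant)
open import Function using (_∘_; _↔_; mk↔ₛ′; Inverse)
open import Function.Definitions using (Injective)
open import Induction.WellFounded using (WellFounded; WfRec; module All; module FixPoint)
open import Level using (0ℓ)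
open import Relation.Binary using (Rel; IsDecPartialOrder)
import Relation.Binary.Construct.NonStrictToStrict as ToStrict
import Relation.Binary.Construct.On as On
open import Relation.Binary.PropositionalEquality
open import Relation.Nullary using (Dec; yes; no; does; contradiction)
open import Relation.Nullary.Decidable using (map′; _×-dec_; _→-dec_; dec-true; dec-false)

------------------------------------------------------------------------
-- ℚ[t]

-- a₀ ∷ a₁ ∷ … is a₀ + a₁ t + …; trailing zeros are allowed, so equality of
-- polynomials is _≈_, not _≡_.
ℚ[t] : Set
ℚ[t] = List ℚ

coeff : ℚ[t] → ℕ → ℚ
coeff []      _       = 0ℚ
coeff (a ∷ f) zero    = a
coeff (a ∷ f) (suc k) = coeff f k

infix 4 _≈_
_≈_ : Rel ℚ[t] 0ℓ
f ≈ g = ∀ k → coeff f k ≡ coeff g k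

eval : ℚ[t] → ℚ → ℚ
eval []      x = 0ℚ
eval (a ∷ f) x = a + x * eval f x

one : ℚ[t]
one = 1ℚ ∷ []

infixl 6 _⊕_ _⊖_
infixl 7 _·_

_⊕_ : ℚ[t] → ℚ[t] → ℚ[t]
[]      ⊕ g       = g
(a ∷ f) ⊕ []      = a ∷ f
(a ∷ f) ⊕ (b ∷ g) = (a + b) ∷ (f ⊕ g)

_·_ : ℚ → ℚ[t] → ℚ[t]
c · f = map (c *_) f

_⊖_ : ℚ[t] → ℚ[t] → ℚ[t]
f ⊖ g = f ⊕ (- 1ℚ) · g

∑ : List ℚ[t] → ℚ[t]
∑ = foldr _⊕_ []

-- f(t+1), by Horner: (a + t f)(t+1) = (a + t f(t+1)) + f(t+1).
shift : ℚ[t] → ℚ[t]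
shift []      = []
shift (a ∷ f) = (a ∷ shift f) ⊕ shift f

Δ : ℚ[t] → ℚ[t]
Δ f = shift f ⊖ f

ι : ℕ → ℚ
ι n = + n / 1

-- The falling factorial t (t-1) ⋯ (t-j+1).
falling : ℕ → ℚ[t]
falling zero    = one
falling (suc j) = (0ℚ ∷ falling j) ⊕ (- ι j) · falling j

-- antidiff f j is Δ⁻¹ of f · falling j, obtained from
-- Δ (falling (j+1)) = (j+1) falling j  and  t · falling j = falling (j+1) + j falling j.
antidiff : ℚ[t] → ℕ → ℚ[t]
antidiff []      j = []
antidiff (a ∷ f) j =
  (a * (+ 1 / suc j)) · falling (suc j) ⊕ antidiff f (suc j) ⊕ ι j · antidiff f j

-- Characterised by Δ⁻¹-zero, Δ-Δ⁻¹ and Δ⁻¹-unique below.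
Δ⁻¹ : ℚ[t] → ℚ[t]
Δ⁻¹ f = antidiff f 0

open +-*-Solver

ι-suc : ∀ n → ι (suc n) ≡ ι n + 1ℚ
ι-suc n = toℚᵘ-injective (begin
  ℚ.toℚᵘ (ι (suc n))            ≈⟨ toℚᵘ-fromℚᵘ (ℚᵘ.mkℚᵘ (+ suc n) 0) ⟩
  ℚᵘ.mkℚᵘ (+ suc n) 0           ≈⟨ ℚᵘ.*≡* eq ⟩
  ℚᵘ.mkℚᵘ (+ n) 0 ℚᵘ.+ ℚᵘ.1ℚᵘ   ≈⟨ ℚᵘ.+-congˡ ℚᵘ.1ℚᵘ (ℚᵘ.≃-sym (toℚᵘ-fromℚᵘ (ℚᵘ.mkℚᵘ (+ n) 0))) ⟩
  ℚ.toℚᵘ (ι n) ℚᵘ.+ ℚᵘ.1ℚᵘ      ≈⟨ ℚᵘ.≃-sym (toℚᵘ-homo-+ (ι n) 1ℚ) ⟩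
  ℚ.toℚᵘ (ι n + 1ℚ)             ∎)
  where
  open ℚᵘ.≃-Reasoning
  eq : + suc n ℤ.* + 1 ≡ (+ n ℤ.* + 1 ℤ.+ + 1 ℤ.* + 1) ℤ.* + 1
  eq = cong (ℤ._* + 1) (trans (cong +_ (sym (ℕ.+-comm n 1)))
                              (cong (ℤ._+ + 1) (sym (ℤ.*-identityʳ (+ n)))))

ι-inverse : ∀ j → (+ 1 / suc j) * ι (suc j) ≡ 1ℚ
ι-inverse j = toℚᵘ-injective (begin
  ℚ.toℚᵘ ((+ 1 / suc j) * ι (suc j))
    ≈⟨ toℚᵘ-homo-* (+ 1 / suc j) (ι (suc j)) ⟩
  ℚ.toℚᵘ (+ 1 / suc j) ℚᵘ.* ℚ.toℚᵘ (ι (suc j))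
    ≈⟨ ℚᵘ.*-cong (toℚᵘ-fromℚᵘ (ℚᵘ.mkℚᵘ (+ 1) j)) (toℚᵘ-fromℚᵘ (ℚᵘ.mkℚᵘ (+ suc j) 0)) ⟩
  ℚᵘ.mkℚᵘ (+ 1) j ℚᵘ.* ℚᵘ.mkℚᵘ (+ suc j) 0
    ≈⟨ ℚᵘ.*≡* eq ⟩
  ℚᵘ.1ℚᵘ ∎)
  where
  open ℚᵘ.≃-Reasoning
  eq : (+ 1 ℤ.* + suc j) ℤ.* + 1 ≡ + 1 ℤ.* (+ suc (j ℕ.* 1))
  eq = trans (ℤ.*-identityʳ _) (cong (λ k → + 1 ℤ.* + suc k) (sym (ℕ.*-identityʳ j)))

eval-⊕ : ∀ f g x → eval (f ⊕ g) x ≡ eval f x + eval g x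
eval-⊕ []      g       x = sym (ℚ.+-identityˡ _)
eval-⊕ (a ∷ f) []      x = sym (ℚ.+-identityʳ _)
eval-⊕ (a ∷ f) (b ∷ g) x rewrite eval-⊕ f g x =
  solve 5 (λ a b x u v → (a :+ b) :+ x :* (u :+ v) := (a :+ x :* u) :+ (b :+ x :* v)) refl
    a b x (eval f x) (eval g x)

eval-· : ∀ c f x → eval (c · f) x ≡ c * eval f x
eval-· c []      x = sym (ℚ.*-zeroʳ c)
eval-· c (a ∷ f) x rewrite eval-· c f x =
  solve 4 (λ c a x u → c :* a :+ x :* (c :* u) := c :* (a :+ x :* u)) refl c a x (eval f x)

eval-⊖ : ∀ f g x → eval (f ⊖ g) x ≡ eval f x - eval g x
eval-⊖ f g x rewrite eval-⊕ f ((- 1ℚ) · g) x | eval-· (- 1ℚ) g x =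
  solve 2 (λ u v → u :+ (:- con 1ℚ) :* v := u :- v) refl (eval f x) (eval g x)

eval-shift : ∀ f x → eval (shift f) x ≡ eval f (x + 1ℚ)
eval-shift []      x = refl
eval-shift (a ∷ f) x rewrite eval-⊕ (a ∷ shift f) (shift f) x | eval-shift f x =
  solve 3 (λ a x u → (a :+ x :* u) :+ u := a :+ (x :+ con 1ℚ) :* u) refl
    a x (eval f (x + 1ℚ))

eval-Δ : ∀ f x → eval (Δ f) x ≡ eval f (x + 1ℚ) - eval f x
eval-Δ f x = trans (eval-⊖ (shift f) f x) (cong (_- eval f x) (eval-shift f x))

private
  Zero : ℚ[t] → Set
  Zero = All (_≡ 0ℚ)

  a+x0≡0⇒a≡0 : ∀ a x u → u ≡ 0ℚ → a + x * u ≡ 0ℚ → a ≡ 0ℚ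
  a+x0≡0⇒a≡0 a x _ refl = trans (solve 2 (λ a x → a := a :+ x :* con 0ℚ) refl a x)

  Zero⇒eval : ∀ {f} x → Zero f → eval f x ≡ 0ℚ
  Zero⇒eval x []         = refl
  Zero⇒eval x (refl ∷ z) rewrite Zero⇒eval x z =
    solve 1 (λ x → con 0ℚ :+ x :* con 0ℚ := con 0ℚ) refl x

  Zero⇒coeff : ∀ {f} → Zero f → ∀ k → coeff f k ≡ 0ℚ
  Zero⇒coeff []      k       = refl
  Zero⇒coeff (z ∷ _) zero    = z
  Zero⇒coeff (_ ∷ z) (suc k) = Zero⇒coeff z k

  coeff⇒Zero : ∀ f → (∀ k → coeff f k ≡ 0ℚ) → Zero f
  coeff⇒Zero []      h = []
  coeff⇒Zero (a ∷ f) h = h 0 ∷ coeff⇒Zero f (h ∘ suc)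

  -- Quotient of f by t - r.
  quot : ℚ → ℚ[t] → ℚ[t]
  quot r []          = []
  quot r (a ∷ [])    = []
  quot r (a ∷ b ∷ f) = eval (b ∷ f) r ∷ quot r (b ∷ f)

  length-quot : ∀ r a f → length (quot r (a ∷ f)) ≡ length f
  length-quot r a []      = refl
  length-quot r a (b ∷ f) = cong suc (length-quot r b f)

  eval-quot : ∀ r f x → eval f x ≡ eval f r + (x - r) * eval (quot r f) x
  eval-quot r [] x =
    solve 2 (λ x r → con 0ℚ := con 0ℚ :+ (x :- r) :* con 0ℚ) refl x r
  eval-quot r (a ∷ []) x =
    solve 3 (λ a x r → a :+ x :* con 0ℚ := (a :+ r :* con 0ℚ) :+ (x :- r) :* con 0ℚ) refl a x r
  eval-quot r (a ∷ b ∷ f) x =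
    trans (cong (λ u → a + x * u) (eval-quot r (b ∷ f) x))
      (solve 5 (λ a x r u v → a :+ x :* (u :+ (x :- r) :* v)
                           := (a :+ r :* u) :+ (x :- r) :* (u :+ x :* v)) refl
        a x r (eval (b ∷ f) r) (eval (quot r (b ∷ f)) x))

  quot-Zero : ∀ r f → Zero (quot r f) → eval f r ≡ 0ℚ → Zero f
  quot-Zero r []          _       _ = []
  quot-Zero r (a ∷ [])    _       e = a+x0≡0⇒a≡0 a r _ refl e ∷ []
  quot-Zero r (a ∷ b ∷ f) (u ∷ z) e = a+x0≡0⇒a≡0 a r _ u e ∷ quot-Zero r (b ∷ f) z u

  vanishing : ∀ m r f → length f ℕ.≤ m → (∀ n → eval f (r + ι n) ≡ 0ℚ) → Zero f
  vanishing m       r []      _       h = []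
  vanishing (suc m) r (a ∷ f) (s≤s l) h = quot-Zero r (a ∷ f) z root
    where
    root : eval (a ∷ f) r ≡ 0ℚ
    root = trans (cong (eval (a ∷ f)) (sym (ℚ.+-identityʳ r))) (h 0)

    q = quot r (a ∷ f)

    h′ : ∀ n → eval q (r + 1ℚ + ι n) ≡ 0ℚ
    h′ n = begin
      u                                       ≡⟨ sym (ℚ.*-identityˡ u) ⟩
      1ℚ * u                                  ≡⟨ cong (_* u) (sym (ι-inverse n)) ⟩
      ((+ 1 / suc n) * ι (suc n)) * u         ≡⟨ ℚ.*-assoc (+ 1 / suc n) (ι (suc n)) u ⟩
      (+ 1 / suc n) * (ι (suc n) * u)         ≡⟨ cong ((+ 1 / suc n) *_) eq ⟩
      (+ 1 / suc n) * 0ℚ                      ≡⟨ ℚ.*-zeroʳ (+ 1 / suc n) ⟩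
      0ℚ                                      ∎
      where
      open ≡-Reasoning
      y = r + 1ℚ + ι n
      u = eval q y
      y≡ : y ≡ r + ι (suc n)
      y≡ = trans (solve 2 (λ r i → r :+ con 1ℚ :+ i := r :+ (i :+ con 1ℚ)) refl r (ι n))
                 (cong (λ i → r + i) (sym (ι-suc n)))
      eq : ι (suc n) * u ≡ 0ℚ
      eq = begin
        ι (suc n) * u                     ≡⟨ cong (_* u) (solve 2 (λ r i → i := (r :+ i) :- r) refl r (ι (suc n))) ⟩
        (r + ι (suc n) - r) * u           ≡⟨ cong (λ w → (w - r) * u) (sym y≡) ⟩
        (y - r) * u                       ≡⟨ sym (ℚ.+-identityˡ _) ⟩
        0ℚ + (y - r) * u                  ≡⟨ cong (_+ (y - r) * u) (sym root) ⟩
        eval (a ∷ f) r + (y - r) * u      ≡⟨ sym (eval-quot r (a ∷ f) y) ⟩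
        eval (a ∷ f) y                    ≡⟨ cong (eval (a ∷ f)) y≡ ⟩
        eval (a ∷ f) (r + ι (suc n))      ≡⟨ h (suc n) ⟩
        0ℚ                                ∎

    z : Zero q
    z = vanishing m (r + 1ℚ) q (ℕ.≤-trans (ℕ.≤-reflexive (length-quot r a f)) l) h′

  coeff-⊕ : ∀ f g k → coeff (f ⊕ g) k ≡ coeff f k + coeff g k
  coeff-⊕ []      g       k       = sym (ℚ.+-identityˡ _)
  coeff-⊕ (a ∷ f) []      k       = sym (ℚ.+-identityʳ _)
  coeff-⊕ (a ∷ f) (b ∷ g) zero    = refl
  coeff-⊕ (a ∷ f) (b ∷ g) (suc k) = coeff-⊕ f g k

  coeff-· : ∀ c f k → coeff (c · f) k ≡ c * coeff f k
  coeff-· c []      k       = sym (ℚ.*-zeroʳ c)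
  coeff-· c (a ∷ f) zero    = refl
  coeff-· c (a ∷ f) (suc k) = coeff-· c f k

  coeff-⊖ : ∀ f g k → coeff (f ⊖ g) k ≡ coeff f k - coeff g k
  coeff-⊖ f g k rewrite coeff-⊕ f ((- 1ℚ) · g) k | coeff-· (- 1ℚ) g k =
    solve 2 (λ u v → u :+ (:- con 1ℚ) :* v := u :- v) refl (coeff f k) (coeff g k)

  -‿zero : ∀ {u v} → u ≡ v → u - v ≡ 0ℚ
  -‿zero {u} refl = ℚ.+-inverseʳ u

  -‿zero⁻¹ : ∀ u v → u - v ≡ 0ℚ → u ≡ v
  -‿zero⁻¹ u v e = trans (solve 2 (λ u v → u := (u :- v) :+ v) refl u v)
                         (trans (cong (_+ v) e) (ℚ.+-identityˡ v))

eval-cong : ∀ {f g} → f ≈ g → ∀ x → eval f x ≡ eval g x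
eval-cong {f} {g} f≈g x = -‿zero⁻¹ _ _ (trans (sym (eval-⊖ f g x))
  (Zero⇒eval x (coeff⇒Zero (f ⊖ g) λ k → trans (coeff-⊖ f g k) (-‿zero (f≈g k)))))

eval-injective : ∀ r f g → (∀ n → eval f (r + ι n) ≡ eval g (r + ι n)) → f ≈ g
eval-injective r f g h k = -‿zero⁻¹ _ _ (trans (sym (coeff-⊖ f g k))
  (Zero⇒coeff (vanishing _ r (f ⊖ g) ℕ.≤-refl λ n → trans (eval-⊖ f g _) (-‿zero (h n))) k))

private
  eval-falling : ∀ j x → eval (falling (suc j)) x ≡ (x - ι j) * eval (falling j) x
  eval-falling j x = begin
    eval ((0ℚ ∷ falling j) ⊕ (- ι j) · falling j) x  ≡⟨ eval-⊕ (0ℚ ∷ falling j) ((- ι j) · falling j) x ⟩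
    (0ℚ + x * u) + eval ((- ι j) · falling j) x      ≡⟨ cong (λ v → (0ℚ + x * u) + v) (eval-· (- ι j) (falling j) x) ⟩
    (0ℚ + x * u) + (- ι j) * u                       ≡⟨ lemma x (ι j) u ⟩
    (x - ι j) * u                                    ∎
    where
    open ≡-Reasoning
    u = eval (falling j) x
    lemma : ∀ x i u → (0ℚ + x * u) + (- i) * u ≡ (x - i) * u
    lemma = solve 3 (λ x i u → (con 0ℚ :+ x :* u) :+ (:- i) :* u := (x :- i) :* u) refl

  falling-zero : ∀ j → eval (falling (suc j)) 0ℚ ≡ 0ℚ
  falling-zero zero    = refl
  falling-zero (suc j) = trans (eval-falling (suc j) 0ℚ)
    (trans (cong ((0ℚ - ι (suc j)) *_) (falling-zero j)) (ℚ.*-zeroʳ (0ℚ - ι (suc j))))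

  falling-suc : ∀ j x → eval (falling (suc j)) (x + 1ℚ) ≡ (x + 1ℚ) * eval (falling j) x
  falling-suc zero    x = trans (eval-falling 0 (x + 1ℚ)) (lemma x)
    where
    lemma : ∀ x → (x + 1ℚ - 0ℚ) * (1ℚ + (x + 1ℚ) * 0ℚ) ≡ (x + 1ℚ) * (1ℚ + x * 0ℚ)
    lemma = solve 1 (λ x → (x :+ con 1ℚ :- con 0ℚ) :* (con 1ℚ :+ (x :+ con 1ℚ) :* con 0ℚ)
                         := (x :+ con 1ℚ) :* (con 1ℚ :+ x :* con 0ℚ)) refl
  falling-suc (suc j) x = begin
    eval (falling (suc (suc j))) (x + 1ℚ)                    ≡⟨ eval-falling (suc j) (x + 1ℚ) ⟩
    (x + 1ℚ - ι (suc j)) * eval (falling (suc j)) (x + 1ℚ)   ≡⟨ cong₂ (λ i v → (x + 1ℚ - i) * v) (ι-suc j) (falling-suc j x) ⟩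
    (x + 1ℚ - (ι j + 1ℚ)) * ((x + 1ℚ) * u)                   ≡⟨ lemma x (ι j) u ⟩
    (x + 1ℚ) * ((x - ι j) * u)                               ≡⟨ cong ((x + 1ℚ) *_) (sym (eval-falling j x)) ⟩
    (x + 1ℚ) * eval (falling (suc j)) x                      ∎
    where
    open ≡-Reasoning
    u = eval (falling j) x
    lemma : ∀ x i u → (x + 1ℚ - (i + 1ℚ)) * ((x + 1ℚ) * u) ≡ (x + 1ℚ) * ((x - i) * u)
    lemma = solve 3 (λ x i u → (x :+ con 1ℚ :- (i :+ con 1ℚ)) :* ((x :+ con 1ℚ) :* u)
                             := (x :+ con 1ℚ) :* ((x :- i) :* u)) refl

  Δ-falling : ∀ j x → eval (falling (suc j)) (x + 1ℚ) - eval (falling (suc j)) x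
                    ≡ ι (suc j) * eval (falling j) x
  Δ-falling j x = begin
    eval (falling (suc j)) (x + 1ℚ) - eval (falling (suc j)) x ≡⟨ cong₂ _-_ (falling-suc j x) (eval-falling j x) ⟩
    (x + 1ℚ) * u - (x - ι j) * u                               ≡⟨ lemma x (ι j) u ⟩
    (ι j + 1ℚ) * u                                             ≡⟨ cong (_* u) (sym (ι-suc j)) ⟩
    ι (suc j) * u                                              ∎
    where
    open ≡-Reasoning
    u = eval (falling j) x
    lemma : ∀ x i u → (x + 1ℚ) * u - (x - i) * u ≡ (i + 1ℚ) * u
    lemma = solve 3 (λ x i u → (x :+ con 1ℚ) :* u :- (x :- i) :* u := (i :+ con 1ℚ) :* u) refl

  eval-combination : ∀ c f g d h x →
    eval (c · f ⊕ g ⊕ d · h) x ≡ c * eval f x + eval g x + d * eval h x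
  eval-combination c f g d h x = begin
    eval (c · f ⊕ g ⊕ d · h) x                    ≡⟨ eval-⊕ (c · f ⊕ g) (d · h) x ⟩
    eval (c · f ⊕ g) x + eval (d · h) x           ≡⟨ cong₂ _+_ (eval-⊕ (c · f) g x) (eval-· d h x) ⟩
    eval (c · f) x + eval g x + d * eval h x      ≡⟨ cong (λ v → v + eval g x + d * eval h x) (eval-· c f x) ⟩
    c * eval f x + eval g x + d * eval h x        ∎
    where open ≡-Reasoning

  eval-antidiff : ∀ a f j x → eval (antidiff (a ∷ f) j) x
                            ≡ (a * (+ 1 / suc j)) * eval (falling (suc j)) x
                              + eval (antidiff f (suc j)) x + ι j * eval (antidiff f j) x
  eval-antidiff a f j =
    eval-combination (a * (+ 1 / suc j)) (falling (suc j)) (antidiff f (suc j)) (ι j) (antidiff f j)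

  antidiff-zero : ∀ f j → eval (antidiff f j) 0ℚ ≡ 0ℚ
  antidiff-zero []      j = refl
  antidiff-zero (a ∷ f) j = trans (eval-antidiff a f j 0ℚ)
    (lemma (a * (+ 1 / suc j)) (ι j) (falling-zero j) (antidiff-zero f (suc j)) (antidiff-zero f j))
    where
    lemma′ : ∀ c i → c * 0ℚ + 0ℚ + i * 0ℚ ≡ 0ℚ
    lemma′ = solve 2 (λ c i → c :* con 0ℚ :+ con 0ℚ :+ i :* con 0ℚ := con 0ℚ) refl
    lemma : ∀ c i {u v w} → u ≡ 0ℚ → v ≡ 0ℚ → w ≡ 0ℚ → c * u + v + i * w ≡ 0ℚ
    lemma c i refl refl refl = lemma′ c i

  Δ-antidiff-step : ∀ a r s i x u e {F⁺ F G⁺ G H⁺ H} → r * s ≡ 1ℚ →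
    F⁺ - F ≡ s * u → G⁺ - G ≡ e * ((x - i) * u) → H⁺ - H ≡ e * u →
    (a * r * F⁺ + G⁺ + i * H⁺) - (a * r * F + G + i * H) ≡ (a + x * e) * u
  Δ-antidiff-step a r s i x u e {F⁺} {F} {G⁺} {G} {H⁺} {H} rs Fe Ge He = begin
    (a * r * F⁺ + G⁺ + i * H⁺) - (a * r * F + G + i * H)  ≡⟨ regroup (a * r) i F⁺ F G⁺ G H⁺ H ⟩
    a * r * (F⁺ - F) + (G⁺ - G) + i * (H⁺ - H)
      ≡⟨ cong₂ _+_ (cong₂ _+_ (cong (a * r *_) Fe) Ge) (cong (i *_) He) ⟩
    a * r * (s * u) + e * ((x - i) * u) + i * (e * u)     ≡⟨ collect a r s x i u e ⟩
    (a * (r * s) + x * e) * u                             ≡⟨ cong (λ w → (a * w + x * e) * u) rs ⟩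
    (a * 1ℚ + x * e) * u                                  ≡⟨ cong (λ w → (w + x * e) * u) (ℚ.*-identityʳ a) ⟩
    (a + x * e) * u                                       ∎
    where
    open ≡-Reasoning
    regroup : ∀ c i F⁺ F G⁺ G H⁺ H → (c * F⁺ + G⁺ + i * H⁺) - (c * F + G + i * H)
                                   ≡ c * (F⁺ - F) + (G⁺ - G) + i * (H⁺ - H)
    regroup = solve 8 (λ c i F⁺ F G⁺ G H⁺ H →
      (c :* F⁺ :+ G⁺ :+ i :* H⁺) :- (c :* F :+ G :+ i :* H)
      := c :* (F⁺ :- F) :+ (G⁺ :- G) :+ i :* (H⁺ :- H)) refl
    collect : ∀ a r s x i u e → a * r * (s * u) + e * ((x - i) * u) + i * (e * u)
                              ≡ (a * (r * s) + x * e) * u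
    collect = solve 7 (λ a r s x i u e →
      a :* r :* (s :* u) :+ e :* ((x :- i) :* u) :+ i :* (e :* u)
      := (a :* (r :* s) :+ x :* e) :* u) refl

  Δ-antidiff : ∀ f j x → eval (antidiff f j) (x + 1ℚ) - eval (antidiff f j) x
                       ≡ eval f x * eval (falling j) x
  Δ-antidiff []      j x = sym (ℚ.*-zeroˡ (eval (falling j) x))
  Δ-antidiff (a ∷ f) j x = trans
    (cong₂ _-_ (eval-antidiff a f j (x + 1ℚ)) (eval-antidiff a f j x))
    (Δ-antidiff-step a (+ 1 / suc j) (ι (suc j)) (ι j) x (eval (falling j) x) (eval f x)
      (ι-inverse j) (Δ-falling j x)
      (trans (Δ-antidiff f (suc j) x) (cong (eval f x *_) (eval-falling j x)))
      (Δ-antidiff f j x))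

Δ⁻¹-zero : ∀ f → eval (Δ⁻¹ f) 0ℚ ≡ 0ℚ
Δ⁻¹-zero f = antidiff-zero f 0

Δ-Δ⁻¹ : ∀ f → Δ (Δ⁻¹ f) ≈ f
Δ-Δ⁻¹ f = eval-injective 0ℚ (Δ (Δ⁻¹ f)) f λ n → let x = 0ℚ + ι n in
  trans (eval-Δ (Δ⁻¹ f) x) (trans (Δ-antidiff f 0 x) (lemma (eval f x) x))
  where
  lemma : ∀ u x → u * (1ℚ + x * 0ℚ) ≡ u
  lemma = solve 2 (λ u x → u :* (con 1ℚ :+ x :* con 0ℚ) := u) refl

Δ⁻¹-unique : ∀ f g → eval g 0ℚ ≡ 0ℚ → Δ g ≈ f → g ≈ Δ⁻¹ f
Δ⁻¹-unique f g g0 Δg≈f = eval-injective 0ℚ g (Δ⁻¹ f) λ n →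
  subst (λ x → eval g x ≡ eval (Δ⁻¹ f) x) (sym (ℚ.+-identityˡ (ι n))) (agree n)
  where
  agree : ∀ n → eval g (ι n) ≡ eval (Δ⁻¹ f) (ι n)
  agree zero    = trans g0 (sym (Δ⁻¹-zero f))
  agree (suc n) = subst (λ y → eval g y ≡ eval (Δ⁻¹ f) y) (sym (ι-suc n)) (begin
    eval g (x + 1ℚ)                       ≡⟨ step (eval g (x + 1ℚ)) (eval g x) ⟩
    (eval g (x + 1ℚ) - eval g x) + eval g x ≡⟨ cong₂ _+_ (trans (sym (eval-Δ g x)) (trans same (eval-Δ h x))) (agree n) ⟩
    (eval h (x + 1ℚ) - eval h x) + eval h x ≡⟨ sym (step (eval h (x + 1ℚ)) (eval h x)) ⟩
    eval h (x + 1ℚ)                       ∎)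
    where
    open ≡-Reasoning
    x = ι n
    h = Δ⁻¹ f
    step : ∀ u v → u ≡ (u - v) + v
    step = solve 2 (λ u v → u := (u :- v) :+ v) refl
    same : eval (Δ g) x ≡ eval (Δ h) x
    same = eval-cong {Δ g} {Δ h} (λ k → trans (Δg≈f k) (sym (Δ-Δ⁻¹ f k))) x

------------------------------------------------------------------------
-- Labeled posets

record LabeledPoset : Set₁ where
  field
    Carrier           : Set
    size              : ℕ
    enum              : Fin size ↔ Carrier
    _≤_               : Rel Carrier 0ℓ
    isDecPartialOrder : IsDecPartialOrder _≡_ _≤_
    ω                 : Carrier → ℕ
    ω-positive        : ∀ x → 0 ℕ.< ω x
    ω-injective       : Injective _≡_ _≡_ ω

  open IsDecPartialOrder isDecPartialOrder public
    using (_≟_; _≤?_; isPartialOrder; antisym) renaming (refl to ≤-refl; trans to ≤-trans)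
  open ToStrict _≡_ _≤_ public using (_<_)

  _<?_ : ∀ x y → Dec (x < y)
  _<?_ = ToStrict.<-decidable _≡_ _≤_ _≟_ _≤?_

  open Inverse enum public using () renaming
    (to to at; from to index; strictlyInverseˡ to at-index; strictlyInverseʳ to index-at)

  ∀? : {Q : Carrier → Set} → (∀ x → Dec (Q x)) → Dec (∀ x → Q x)
  ∀? {Q} Q? = map′ (λ h x → subst Q (at-index x) (h (index x))) (λ h i → h (at i))
                   (Fin.all? (Q? ∘ at))

  -- A subset of the carrier is encoded by the set of indices of its elements.
  infix 4 _∈ₚ_
  _∈ₚ_ : Carrier → Subset size → Set
  x ∈ₚ S = index x ∈ S

open LabeledPoset using (size)

-- The k-th element of S, and its inverse: they enumerate the carrier of induced P S.
members : ∀ {n} (S : Subset n) → Fin ∣ S ∣ → Σ (Fin n) (_∈ S)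
members (inside  ∷ S) Fin.zero    = Fin.zero , here
members (inside  ∷ S) (Fin.suc k) = let i , i∈S = members S k in Fin.suc i , there i∈S
members (outside ∷ S) k           = let i , i∈S = members S k in Fin.suc i , there i∈S

position : ∀ {n} (S : Subset n) (i : Fin n) → i ∈ S → Fin ∣ S ∣
position (inside  ∷ S) Fin.zero    _           = Fin.zero
position (inside  ∷ S) (Fin.suc i) (there i∈S) = Fin.suc (position S i i∈S)
position (outside ∷ S) (Fin.suc i) (there i∈S) = position S i i∈S

members-position : ∀ {n} (S : Subset n) i (i∈S : i ∈ S) →
                   proj₁ (members S (position S i i∈S)) ≡ i
members-position (inside  ∷ S) Fin.zero    _           = refl
members-position (inside  ∷ S) (Fin.suc i) (there i∈S) = cong Fin.suc (members-position S i i∈S)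
members-position (outside ∷ S) (Fin.suc i) (there i∈S) = cong Fin.suc (members-position S i i∈S)

position-members : ∀ {n} (S : Subset n) k →
                   position S (proj₁ (members S k)) (proj₂ (members S k)) ≡ k
position-members (inside  ∷ S) Fin.zero    = refl
position-members (inside  ∷ S) (Fin.suc k) = cong Fin.suc (position-members S k)
position-members (outside ∷ S) k           = position-members S k

module _ (P : LabeledPoset) (S : Subset (size P)) where
  open LabeledPoset P

  private
    Sub : Set
    Sub = Σ Carrier (_∈ₚ S)

    Sub-≡ : {x y : Sub} → proj₁ x ≡ proj₁ y → x ≡ y
    Sub-≡ {x , p} {_ , q} refl = cong (x ,_) ([]=-irrelevant p q)

    to : Fin ∣ S ∣ → Sub
    to k = let i , i∈S = members S k in at i , subst (_∈ S) (sym (index-at i)) i∈S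

    from : Sub → Fin ∣ S ∣
    from (x , x∈S) = position S (index x) x∈S

    to-from : ∀ x → to (from x) ≡ x
    to-from (x , x∈S) = Sub-≡ (trans (cong at (members-position S (index x) x∈S)) (at-index x))

    position-≡ : ∀ {i j} (p : i ∈ S) (q : j ∈ S) → i ≡ j → position S i p ≡ position S j q
    position-≡ p q refl = cong (position S _) ([]=-irrelevant p q)

    from-to : ∀ k → from (to k) ≡ k
    from-to k = let i , i∈S = members S k in
      trans (position-≡ _ i∈S (index-at i)) (position-members S k)

  -- S with the induced order and labeling.
  induced : LabeledPoset
  induced = record
    { Carrier           = Sub
    ; size              = ∣ S ∣
    ; enum              = mk↔ₛ′ to from to-from from-to
    ; _≤_               = λ x y → proj₁ x ≤ proj₁ y
    ; isDecPartialOrder = record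
      { isPartialOrder = record
        { isPreorder = record
          { isEquivalence = isEquivalence
          ; reflexive     = λ { refl → ≤-refl }
          ; trans         = ≤-trans
          }
        ; antisym = λ x≤y y≤x → Sub-≡ (antisym x≤y y≤x)
        }
      ; _≟_  = λ x y → map′ Sub-≡ (cong proj₁) (proj₁ x ≟ proj₁ y)
      ; _≤?_ = λ x y → proj₁ x ≤? proj₁ y
      }
    ; ω                 = λ x → ω (proj₁ x)
    ; ω-positive        = λ x → ω-positive (proj₁ x)
    ; ω-injective       = λ eq → Sub-≡ (ω-injective eq)
    }

infixl 6 _∖_
_∖_ : (P : LabeledPoset) → Subset (size P) → LabeledPoset
P ∖ S = induced P (∁ S)

-- All vectors of length m with entries from the list, in lexicographic order.
vectors : {A : Set} → List A → (m : ℕ) → List (Vec A m)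
vectors as zero    = [] ∷ []
vectors as (suc m) = cartesianProductWith _∷_ as (vectors as m)

module _ (P : LabeledPoset) where
  open LabeledPoset P hiding (size)

  IsIdeal : Subset (size P) → Set
  IsIdeal S = ∀ x y → x ≤ y → y ∈ₚ S → x ∈ₚ S

  IsNatural : Subset (size P) → Set
  IsNatural S = ∀ x y → x ∈ₚ S → y ∈ₚ S → x ≤ y → ω x ℕ.≤ ω y

  _∈𝓘 : Subset (size P) → Set
  S ∈𝓘 = IsIdeal S × IsNatural S

  NonemptyNaturalIdeal : Subset (size P) → Set
  NonemptyNaturalIdeal S = Nonempty S × S ∈𝓘

  nonemptyNaturalIdeal? : ∀ S → Dec (NonemptyNaturalIdeal S)
  nonemptyNaturalIdeal? S = nonempty? S
    ×-dec ∀? (λ x → ∀? λ y → x ≤? y →-dec index y ∈? S →-dec index x ∈? S)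
    ×-dec ∀? (λ x → ∀? λ y → index x ∈? S →-dec index y ∈? S →-dec x ≤? y →-dec ω x ℕ.≤? ω y)

  -- The non-empty elements of 𝓘_ω(P).
  nonemptyNaturalIdeals : List (Subset (size P))
  nonemptyNaturalIdeals = filter nonemptyNaturalIdeal? (vectors (outside ∷ inside ∷ []) (size P))

  -- Fin n, with its usual order, plays the role of [n].
  IsωOrderPreserving : ∀ {n} → (Carrier → Fin n) → Set
  IsωOrderPreserving f = (∀ x y → x ≤ y → f x Fin.≤ f y)
                       × (∀ x y → y < x → ω x ℕ.< ω y → f y Fin.< f x)

  isωOrderPreserving? : ∀ {n} (f : Carrier → Fin n) → Dec (IsωOrderPreserving f)
  isωOrderPreserving? f =
    ∀? (λ x → ∀? λ y → x ≤? y →-dec f x Fin.≤? f y)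
    ×-dec ∀? (λ x → ∀? λ y → y <? x →-dec ω x ℕ.<? ω y →-dec f y Fin.<? f x)

  -- A vector v stands for the map whose value at the i-th element is the i-th entry.
  toMap : ∀ {n} → Vec (Fin n) (size P) → Carrier → Fin n
  toMap v x = lookup v (index x)

  #ωOrderPreserving : ℕ → ℕ
  #ωOrderPreserving n =
    length (filter (λ v → isωOrderPreserving? (toMap v)) (vectors (allFin n) (size P)))

  -- Ω(P,ω;t) is the unique f with this property.
  IsOrderPolynomial : ℚ[t] → Set
  IsOrderPolynomial f = ∀ n → 0 ℕ.< n → eval f (ι n) ≡ ι (#ωOrderPreserving n)

------------------------------------------------------------------------
-- The invariant Ψ

private
  _⊏_ : LabeledPoset → LabeledPoset → Set
  Q ⊏ P = size Q ℕ.< size P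

  ⊏-wellFounded : WellFounded _⊏_
  ⊏-wellFounded = On.wellFounded size <-wellFounded

  nonempty⇒0<∣S∣ : ∀ {n} (S : Subset n) → Nonempty S → 0 ℕ.< ∣ S ∣
  nonempty⇒0<∣S∣ S (i , i∈S) = ℕ.≤-trans (s≤s z≤n) (x∈p⇒∣p-x∣<∣p∣ i∈S)

  ∖-⊏ : ∀ P S → Nonempty S → (P ∖ S) ⊏ P
  ∖-⊏ P S ne = subst (ℕ._< size P) (sym (∣∁p∣≡n∸∣p∣ S))
    (ℕ.∸-monoʳ-< (nonempty⇒0<∣S∣ S ne) (∣p∣≤n S))

  idealsWithProof : ∀ P → List (∃ (NonemptyNaturalIdeal P))
  idealsWithProof P =
    toList (all-filter (nonemptyNaturalIdeal? P) (vectors (outside ∷ inside ∷ []) (size P)))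

  -- The recursion for Ψ, with the values on smaller posets supplied by rec.
  Ψ-sum : (P : LabeledPoset) → (∀ Q → Q ⊏ P → ℚ[t]) → ℚ[t]
  Ψ-sum P rec =
    Δ⁻¹ (∑ (map (λ (S , nonempty , _) → rec (P ∖ S) (∖-⊏ P S nonempty)) (idealsWithProof P)))

  Ψ-step : (P : LabeledPoset) → WfRec _⊏_ (λ _ → ℚ[t]) P → ℚ[t]
  Ψ-step P rec = if does (size P ℕ.≟ 0) then one else Ψ-sum P (λ Q Q⊏P → rec {Q} Q⊏P)

-- Characterised by Ψ-empty and Ψ-nonempty below.
Ψ : LabeledPoset → ℚ[t]
Ψ = All.wfRec ⊏-wellFounded 0ℓ (λ _ → ℚ[t]) Ψ-step

private
  Ψ-sum-cong : ∀ P {r r′ : ∀ Q → Q ⊏ P → ℚ[t]} →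
               (∀ Q (Q⊏P : Q ⊏ P) → r Q Q⊏P ≡ r′ Q Q⊏P) → Ψ-sum P r ≡ Ψ-sum P r′
  Ψ-sum-cong P eq = cong (λ fs → Δ⁻¹ (∑ fs))
    (map-cong (λ (S , nonempty , _) → eq (P ∖ S) (∖-⊏ P S nonempty)) (idealsWithProof P))

  Ψ-step-cong : ∀ P {IH IH′ : WfRec _⊏_ (λ _ → ℚ[t]) P} →
                (∀ {Q} (Q⊏P : Q ⊏ P) → IH {Q} Q⊏P ≡ IH′ {Q} Q⊏P) →
                Ψ-step P (λ {Q} → IH {Q}) ≡ Ψ-step P (λ {Q} → IH′ {Q})
  Ψ-step-cong P eq = cong (if does (size P ℕ.≟ 0) then one else_)
    (Ψ-sum-cong P (λ Q Q⊏P → eq {Q} Q⊏P))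

  Ψ-unfold : ∀ P → Ψ P ≡ (if does (size P ℕ.≟ 0) then one else Ψ-sum P (λ Q _ → Ψ Q))
  Ψ-unfold P = FixPoint.unfold-wfRec ⊏-wellFounded (λ _ → ℚ[t]) Ψ-step
    (λ P {IH} {IH′} eq → Ψ-step-cong P {λ {Q} → IH {Q}} {λ {Q} → IH′ {Q}} λ {Q} → eq {Q}) {P}

  map-toList : {A B : Set} {R : A → Set} (h : A → B) {xs : List A} (pxs : All R xs) →
               map (λ (x , _) → h x) (toList pxs) ≡ map h xs
  map-toList h []         = refl
  map-toList h (px ∷ pxs) = cong (h _ ∷_) (map-toList h pxs)

Ψ-empty : ∀ P → size P ≡ 0 → Ψ P ≡ one
Ψ-empty P e = trans (Ψ-unfold P)
  (cong (λ b → if b then one else Ψ-sum P (λ Q _ → Ψ Q)) (dec-true (size P ℕ.≟ 0) e))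

Ψ-nonempty : ∀ P → size P ≢ 0 →
             Ψ P ≡ Δ⁻¹ (∑ (map (λ S → Ψ (P ∖ S)) (nonemptyNaturalIdeals P)))
Ψ-nonempty P ne = trans (Ψ-unfold P)
  (trans (cong (λ b → if b then one else Ψ-sum P (λ Q _ → Ψ Q)) (dec-false (size P ℕ.≟ 0) ne))
    (cong (λ fs → Δ⁻¹ (∑ fs)) (map-toList (λ S → Ψ (P ∖ S))
      (all-filter (nonemptyNaturalIdeal? P) (vectors (outside ∷ inside ∷ []) (size P))))))

{-# OPTIONS --safe #-}

-- Summing over the fibre S of a map f : P → [n+1] over its least value gives
--   #(P, n+1) = Σ_S #(P ∖ S, n),
-- because f is ω-order-preserving iff S is an ω-natural ideal and f restricted to P ∖ S is
-- ω-order-preserving. The term S = ∅ is #(P, n), so n ↦ #(P, n) satisfies the difference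
-- equation that defines Ψ; its value at n = 0 is 0 for P ≠ ∅, as Δ⁻¹ demands.
module Submission where

open import Defs
open import Data.Bool using (true; false; if_then_else_)
open import Data.Empty using () renaming (⊥ to Empty)
open import Data.Fin as Fin using (Fin)
open import Data.Fin.Subset using (Subset; inside; outside; _∈_; ⊥; ⊤; ∁; ∣_∣; Nonempty)
open import Data.Fin.Subset.Properties
  using (_∈?_; ∉⊥; ⊆-max; ∈⊤; ∣⊤∣≡n; p⊂q⇒∣p∣<∣q∣; x∈p⇒x∉∁p; x∉p⇒x∈∁p)
open import Data.List using (List; []; _∷_; _++_; map; filter; length; allFin; cartesianProductWith)
open import Data.List.Properties
  using (map-cong; map-∘; map-++; map-tabulate)
open import Data.List.Relation.Unary.All as All using (All; []; _∷_)
open import Data.List.Relation.Unary.All.Properties using (all-filter)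
open import Data.Nat as ℕ using (ℕ; zero; suc; z≤n; s≤s)
open import Data.Nat.Induction using (<-rec)
open import Data.Nat.ListAction using (sum)
open import Data.Nat.ListAction.Properties using (sum-++)
import Data.Nat.Properties as ℕ
open import Algebra.Properties.CommutativeSemigroup ℕ.+-commutativeSemigroup using (interchange)
open import Data.Product using (∃!; _×_; _,_; proj₁; proj₂)
open import Data.Rational using (ℚ; 0ℚ; 1ℚ; _+_; _-_)
import Data.Rational.Properties as ℚ
open import Data.Rational.Solver using (module +-*-Solver)
open import Data.Vec as Vec using (Vec; []; _∷_; lookup; here; there)
open import Data.Vec.Properties using (lookup-map)
open import Function using (_∘_; _⇔_; mk⇔; Equivalence)
open import Relation.Binary.PropositionalEquality
open import Relation.Nullary using (Dec; yes; no; does; contradiction)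
open import Relation.Nullary.Decidable using (dec-true; dec-false; does-⇔)

private variable
  A B : Set
  m n : ℕ

-- Finite sums

∑[_] : List A → (A → ℕ) → ℕ
∑[ xs ] f = sum (map f xs)

∑-cong : {f g : A → ℕ} → (∀ x → f x ≡ g x) → ∀ xs → ∑[ xs ] f ≡ ∑[ xs ] g
∑-cong eq xs = cong sum (map-cong eq xs)

∑-zero : (xs : List A) → ∑[ xs ] (λ _ → 0) ≡ 0
∑-zero []       = refl
∑-zero (_ ∷ xs) = ∑-zero xs

∑-++ : ∀ xs ys (f : A → ℕ) → ∑[ xs ++ ys ] f ≡ ∑[ xs ] f ℕ.+ ∑[ ys ] f
∑-++ xs ys f = trans (cong sum (map-++ f xs ys)) (sum-++ (map f xs) (map f ys))

∑-map : (h : A → B) (xs : List A) (f : B → ℕ) → ∑[ map h xs ] f ≡ ∑[ xs ] (f ∘ h)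
∑-map h xs f = cong sum (sym (map-∘ xs))

∑-+ : ∀ xs (f g : A → ℕ) → ∑[ xs ] (λ x → f x ℕ.+ g x) ≡ ∑[ xs ] f ℕ.+ ∑[ xs ] g
∑-+ []       f g = refl
∑-+ (x ∷ xs) f g = trans (cong (f x ℕ.+ g x ℕ.+_) (∑-+ xs f g)) (interchange (f x) (g x) _ _)

∑-swap : (xs : List A) (ys : List B) (f : A → B → ℕ) →
         ∑[ xs ] (λ x → ∑[ ys ] (f x)) ≡ ∑[ ys ] (λ y → ∑[ xs ] (λ x → f x y))
∑-swap []       ys f = sym (∑-zero ys)
∑-swap (x ∷ xs) ys f = trans (cong (∑[ ys ] (f x) ℕ.+_) (∑-swap xs ys f))
                             (sym (∑-+ ys (f x) (λ y → ∑[ xs ] (λ x′ → f x′ y))))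

∑-filter : {Q : A → Set} (Q? : ∀ x → Dec (Q x)) (f : A → ℕ) → ∀ xs →
           ∑[ filter Q? xs ] f ≡ ∑[ xs ] (λ x → if does (Q? x) then f x else 0)
∑-filter Q? f []       = refl
∑-filter Q? f (x ∷ xs) with does (Q? x)
... | true  = cong (f x ℕ.+_) (∑-filter Q? f xs)
... | false = ∑-filter Q? f xs

𝟙[_] : {Q : Set} → Dec Q → ℕ
𝟙[ Q? ] = if does Q? then 1 else 0

length≡∑1 : (xs : List A) → length xs ≡ ∑[ xs ] (λ _ → 1)
length≡∑1 []       = refl
length≡∑1 (_ ∷ xs) = cong suc (length≡∑1 xs)

length-filter-∑ : {Q : A → Set} (Q? : ∀ x → Dec (Q x)) → ∀ xs →
                  length (filter Q? xs) ≡ ∑[ xs ] (λ x → 𝟙[ Q? x ])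
length-filter-∑ Q? xs = trans (length≡∑1 (filter Q? xs)) (∑-filter Q? (λ _ → 1) xs)

𝟙-cong : {Q R : Set} → Q ⇔ R → (Q? : Dec Q) (R? : Dec R) → 𝟙[ Q? ] ≡ 𝟙[ R? ]
𝟙-cong Q⇔R Q? R? = cong (if_then 1 else 0) (does-⇔ Q⇔R Q? R?)

∑-vectors : ∀ (as : List A) m (f : Vec A (suc m) → ℕ) →
            ∑[ vectors as (suc m) ] f ≡ ∑[ as ] (λ a → ∑[ vectors as m ] (λ v → f (a ∷ v)))
∑-vectors as m f = go as
  where
  go : ∀ bs → ∑[ cartesianProductWith _∷_ bs (vectors as m) ] f
            ≡ ∑[ bs ] (λ a → ∑[ vectors as m ] (λ v → f (a ∷ v)))
  go []       = refl
  go (b ∷ bs) = trans (∑-++ (map (b ∷_) (vectors as m)) _ f)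
                      (cong₂ ℕ._+_ (∑-map (b ∷_) (vectors as m) f) (go bs))

∑-allFin-suc : ∀ n (f : Fin (suc n) → ℕ) →
               ∑[ allFin (suc n) ] f ≡ f Fin.zero ℕ.+ ∑[ allFin n ] (f ∘ Fin.suc)
∑-allFin-suc n f = cong (f Fin.zero ℕ.+_)
  (trans (cong (λ is → ∑[ is ] f) (sym (map-tabulate (λ i → i) Fin.suc))) (∑-map Fin.suc (allFin n) f))

-- Sums over all subsets

subsets : ∀ m → List (Subset m)
subsets = vectors (outside ∷ inside ∷ [])

∑-subsets : ∀ m (f : Subset (suc m) → ℕ) →
            ∑[ subsets (suc m) ] f ≡ ∑[ subsets m ] (λ S → f (outside ∷ S))
                                  ℕ.+ ∑[ subsets m ] (λ S → f (inside ∷ S))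
∑-subsets m f = trans (∑-vectors (outside ∷ inside ∷ []) m f)
  (cong (∑[ subsets m ] (λ S → f (outside ∷ S)) ℕ.+_) (ℕ.+-identityʳ _))

-- Peels off the term of the empty set. In the induction, `⊥` lies in the half that omits the first
-- index, where the hypothesis applies again; every set in the other half is non-empty, so there the
-- two sums agree term by term.
∑-subsets-⊥ : ∀ {m} (f g : Subset m → ℕ) → (∀ S → Nonempty S → f S ≡ g S) → g ⊥ ≡ 0 →
              ∑[ subsets m ] f ≡ f ⊥ ℕ.+ ∑[ subsets m ] g
∑-subsets-⊥ {zero}  f g f≡g g⊥ = cong (λ k → f [] ℕ.+ (k ℕ.+ 0)) (sym g⊥)
∑-subsets-⊥ {suc m} f g f≡g g⊥ = begin
  ∑[ subsets (suc m) ] f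
    ≡⟨ ∑-subsets m f ⟩
  ∑[ subsets m ] (f ∘ (outside ∷_)) ℕ.+ ∑[ subsets m ] (f ∘ (inside ∷_))
    ≡⟨ cong₂ ℕ._+_
         (∑-subsets-⊥ (f ∘ (outside ∷_)) (g ∘ (outside ∷_))
           (λ { S (i , i∈S) → f≡g (outside ∷ S) (Fin.suc i , there i∈S) }) g⊥)
         (∑-cong (λ S → f≡g (inside ∷ S) (Fin.zero , here)) (subsets m)) ⟩
  (f ⊥ ℕ.+ ∑[ subsets m ] (g ∘ (outside ∷_))) ℕ.+ ∑[ subsets m ] (g ∘ (inside ∷_))
    ≡⟨ ℕ.+-assoc (f ⊥) _ _ ⟩
  f ⊥ ℕ.+ (∑[ subsets m ] (g ∘ (outside ∷_)) ℕ.+ ∑[ subsets m ] (g ∘ (inside ∷_)))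
    ≡⟨ cong (f ⊥ ℕ.+_) (sym (∑-subsets m g)) ⟩
  f ⊥ ℕ.+ ∑[ subsets (suc m) ] g
    ∎
  where open ≡-Reasoning

-- Splitting off the fibre over zero

-- The map whose fibre over zero is exactly `S` and which is `w`, raised by one, elsewhere. The
-- entries of `w` follow the enumeration of `∁ S`, so `w` is at the same time a vector for the poset
-- `P ∖ S`.
merge : (S : Subset m) → Vec (Fin n) ∣ ∁ S ∣ → Vec (Fin (suc n)) m
merge []            []      = []
merge (inside  ∷ S) w       = Fin.zero ∷ merge S w
merge (outside ∷ S) (a ∷ w) = Fin.suc a ∷ merge S w

lookup-merge-∈ : ∀ {S : Subset m} (w : Vec (Fin n) ∣ ∁ S ∣) {i} → i ∈ S →
                 lookup (merge S w) i ≡ Fin.zero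
lookup-merge-∈ {S = inside  ∷ S} w       here        = refl
lookup-merge-∈ {S = inside  ∷ S} w       (there i∈S) = lookup-merge-∈ w i∈S
lookup-merge-∈ {S = outside ∷ S} (_ ∷ w) (there i∈S) = lookup-merge-∈ w i∈S

lookup-merge-∁ : ∀ {S : Subset m} (w : Vec (Fin n) ∣ ∁ S ∣) {i} (i∈∁S : i ∈ ∁ S) →
                 lookup (merge S w) i ≡ Fin.suc (lookup w (position (∁ S) i i∈∁S))
lookup-merge-∁ {S = inside  ∷ S} w       {Fin.suc i} (there p) = lookup-merge-∁ w p
lookup-merge-∁ {S = outside ∷ S} (_ ∷ w) {Fin.zero}  _         = refl
lookup-merge-∁ {S = outside ∷ S} (_ ∷ w) {Fin.suc i} (there p) = lookup-merge-∁ w p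

-- Every vector is `merge S w` for exactly one pair, `S` being its set of zeros. The induction reads
-- the first entry: zero puts the first index inside `S`, and a successor leaves it outside and
-- becomes the head of `w`.
∑-merge : ∀ m n (f : Vec (Fin (suc n)) m → ℕ) →
          ∑[ vectors (allFin (suc n)) m ] f
          ≡ ∑[ subsets m ] (λ S → ∑[ vectors (allFin n) ∣ ∁ S ∣ ] (f ∘ merge S))
∑-merge zero    n f = sym (ℕ.+-identityʳ _)
∑-merge (suc m) n f = begin
  ∑[ vectors (allFin (suc n)) (suc m) ] f
    ≡⟨ ∑-vectors (allFin (suc n)) m f ⟩
  ∑[ allFin (suc n) ] (λ a → ∑[ vectors (allFin (suc n)) m ] (λ v → f (a ∷ v)))
    ≡⟨ ∑-cong (λ a → ∑-merge m n (λ v → f (a ∷ v))) (allFin (suc n)) ⟩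
  ∑[ allFin (suc n) ] (λ a → ∑[ subsets m ] (F a))
    ≡⟨ ∑-allFin-suc n (λ a → ∑[ subsets m ] (F a)) ⟩
  ∑[ subsets m ] (F Fin.zero) ℕ.+ ∑[ allFin n ] (λ a → ∑[ subsets m ] (F (Fin.suc a)))
    -- `allFin` lists zero first, whereas `subsets` lists the sets without the first index first.
    ≡⟨ ℕ.+-comm (∑[ subsets m ] (F Fin.zero)) _ ⟩
  ∑[ allFin n ] (λ a → ∑[ subsets m ] (F (Fin.suc a))) ℕ.+ ∑[ subsets m ] (F Fin.zero)
    -- With `S` outermost, the sum over the head `a` and the sum over the tail join into one sum
    -- over vectors on `∁ (outside ∷ S)`.
    ≡⟨ cong (ℕ._+ ∑[ subsets m ] (F Fin.zero)) (trans
         (∑-swap (allFin n) (subsets m) (F ∘ Fin.suc))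
         (∑-cong (λ S → sym (∑-vectors (allFin n) ∣ ∁ S ∣ (f ∘ merge (outside ∷ S)))) (subsets m))) ⟩
  ∑[ subsets m ] (G ∘ (outside ∷_)) ℕ.+ ∑[ subsets m ] (G ∘ (inside ∷_))
    ≡⟨ sym (∑-subsets m G) ⟩
  ∑[ subsets (suc m) ] G
    ∎
  where
  open ≡-Reasoning
  F : Fin (suc n) → Subset m → ℕ
  F a S = ∑[ vectors (allFin n) ∣ ∁ S ∣ ] (λ w → f (a ∷ merge S w))
  G : Subset (suc m) → ℕ
  G S = ∑[ vectors (allFin n) ∣ ∁ S ∣ ] (f ∘ merge S)

-- The length `∣ ∁ ⊥ ∣` equals `m` only propositionally, so the vectors are reindexed by induction
-- instead of being transported along that equality.
∑-merge-⊥ : ∀ m n (f : Vec (Fin (suc n)) m → ℕ) →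
            ∑[ vectors (allFin n) ∣ ∁ (⊥ {m}) ∣ ] (f ∘ merge ⊥)
            ≡ ∑[ vectors (allFin n) m ] (f ∘ Vec.map Fin.suc)
∑-merge-⊥ zero    n f = refl
∑-merge-⊥ (suc m) n f = begin
  ∑[ vectors (allFin n) (suc ∣ ∁ (⊥ {m}) ∣) ] (f ∘ merge ⊥)
    ≡⟨ ∑-vectors (allFin n) ∣ ∁ (⊥ {m}) ∣ (f ∘ merge ⊥) ⟩
  ∑[ allFin n ] (λ a → ∑[ vectors (allFin n) ∣ ∁ (⊥ {m}) ∣ ] (λ w → f (Fin.suc a ∷ merge ⊥ w)))
    ≡⟨ ∑-cong (λ a → ∑-merge-⊥ m n (λ v → f (Fin.suc a ∷ v))) (allFin n) ⟩
  ∑[ allFin n ] (λ a → ∑[ vectors (allFin n) m ] (λ v → f (Fin.suc a ∷ Vec.map Fin.suc v)))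
    ≡⟨ sym (∑-vectors (allFin n) m (f ∘ Vec.map Fin.suc)) ⟩
  ∑[ vectors (allFin n) (suc m) ] (f ∘ Vec.map Fin.suc)
    ∎
  where open ≡-Reasoning

-- Counting ω-order-preserving maps

open LabeledPoset using (size)

module _ (P : LabeledPoset) where
  open LabeledPoset P hiding (size)

  -- Nothing lies below the value zero. So an element below a member of `S` must be in `S`, and a
  -- drop of labels along a relation inside `S` would demand a strict inequality between zeros.
  -- Conversely, for an ideal the only relations between `S` and its complement go upwards out of
  -- `S`, from zero to a successor, and satisfy both conditions.
  preserving-merge : ∀ S (w : Vec (Fin n) ∣ ∁ S ∣) →
    IsωOrderPreserving P (toMap P (merge S w))
    ⇔ (_∈𝓘 P S × IsωOrderPreserving (P ∖ S) (toMap (P ∖ S) w))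
  preserving-merge {n} S w = mk⇔ forward backward
    where
    f : Carrier → Fin (suc n)
    f = toMap P (merge S w)

    g : LabeledPoset.Carrier (P ∖ S) → Fin n
    g = toMap (P ∖ S) w

    f-∈ : ∀ {x} → x ∈ₚ S → f x ≡ Fin.zero
    f-∈ = lookup-merge-∈ w

    f-∁ : ∀ {x} (x∈∁S : x ∈ₚ ∁ S) → f x ≡ Fin.suc (g (x , x∈∁S))
    f-∁ = lookup-merge-∁ w

    forward : IsωOrderPreserving P f → _∈𝓘 P S × IsωOrderPreserving (P ∖ S) g
    forward (mono , strict) = (ideal , natural) , gmono , gstrict
      where
      ideal : IsIdeal P S
      ideal x y x≤y y∈S with index x ∈? S
      ... | yes x∈S = x∈S
      ... | no  x∉S = contradiction
        (subst₂ Fin._≤_ (f-∁ (x∉p⇒x∈∁p x∉S)) (f-∈ y∈S) (mono x y x≤y)) λ ()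

      natural : IsNatural P S
      natural x y x∈S y∈S x≤y with ω x ℕ.≤? ω y
      ... | yes ωx≤ωy = ωx≤ωy
      ... | no  ωx≰ωy = contradiction
        (subst (f x Fin.<_) (f-∈ y∈S)
          (strict y x (x≤y , λ { refl → ωx≰ωy ℕ.≤-refl }) (ℕ.≰⇒> ωx≰ωy))) λ ()

      gmono : ∀ x y → proj₁ x ≤ proj₁ y → g x Fin.≤ g y
      gmono (x , p) (y , q) x≤y = ℕ.≤-pred (subst₂ Fin._≤_ (f-∁ p) (f-∁ q) (mono x y x≤y))

      gstrict : ∀ x y → LabeledPoset._<_ (P ∖ S) y x → ω (proj₁ x) ℕ.< ω (proj₁ y) → g y Fin.< g x
      -- Strictness in `P ∖ S` speaks of pairs; strictness in `P` is obtained from the unequal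
      -- labels.
      gstrict (x , p) (y , q) (y≤x , _) ωx<ωy = ℕ.≤-pred
        (subst₂ Fin._<_ (f-∁ q) (f-∁ p)
          (strict x y (y≤x , λ { refl → ℕ.<-irrefl refl ωx<ωy }) ωx<ωy))

    backward : _∈𝓘 P S × IsωOrderPreserving (P ∖ S) g → IsωOrderPreserving P f
    backward ((ideal , natural) , gmono , gstrict) = mono , strict
      where
      mono : ∀ x y → x ≤ y → f x Fin.≤ f y
      mono x y x≤y with index x ∈? S | index y ∈? S
      ... | yes x∈S | _       = subst (Fin._≤ f y) (sym (f-∈ x∈S)) z≤n
      ... | no  x∉S | yes y∈S = contradiction (ideal x y x≤y y∈S) x∉S
      ... | no  x∉S | no  y∉S =
        let p = x∉p⇒x∈∁p x∉S; q = x∉p⇒x∈∁p y∉S in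
        subst₂ Fin._≤_ (sym (f-∁ p)) (sym (f-∁ q)) (s≤s (gmono (x , p) (y , q) x≤y))

      strict : ∀ x y → y < x → ω x ℕ.< ω y → f y Fin.< f x
      strict x y (y≤x , y≢x) ωx<ωy with index x ∈? S | index y ∈? S
      -- The ideal `S` then contains `y` as well, and naturality on `S` forbids the drop of labels
      -- from `y` to `x`.
      ... | yes x∈S | _       =
        contradiction (natural y x (ideal y x y≤x x∈S) x∈S y≤x) (ℕ.<⇒≱ ωx<ωy)
      ... | no  x∉S | yes y∈S =
        subst₂ Fin._<_ (sym (f-∈ y∈S)) (sym (f-∁ (x∉p⇒x∈∁p x∉S))) (s≤s z≤n)
      ... | no  x∉S | no  y∉S =
        let p = x∉p⇒x∈∁p x∉S; q = x∉p⇒x∈∁p y∉S in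
        subst₂ Fin._<_ (sym (f-∁ q)) (sym (f-∁ p))
          (s≤s (gstrict (x , p) (y , q) (y≤x , y≢x ∘ cong proj₁) ωx<ωy))

  -- Both conditions only compare values, and the successor preserves and reflects these
  -- comparisons. This identifies the maps that miss the least value.
  preserving-map-suc : (v : Vec (Fin n) (size P)) →
    IsωOrderPreserving P (toMap P (Vec.map Fin.suc v)) ⇔ IsωOrderPreserving P (toMap P v)
  preserving-map-suc v = mk⇔
    (λ (mono , strict) →
        (λ x y x≤y → ℕ.≤-pred (subst₂ Fin._≤_ (eq x) (eq y) (mono x y x≤y)))
      , (λ x y y<x ω< → ℕ.≤-pred (subst₂ Fin._<_ (eq y) (eq x) (strict x y y<x ω<))))
    (λ (mono , strict) →
        (λ x y x≤y → subst₂ Fin._≤_ (sym (eq x)) (sym (eq y)) (s≤s (mono x y x≤y)))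
      , (λ x y y<x ω< → subst₂ Fin._<_ (sym (eq y)) (sym (eq x)) (s≤s (strict x y y<x ω<))))
    where
    eq : ∀ x → toMap P (Vec.map Fin.suc v) x ≡ Fin.suc (toMap P v x)
    eq x = lookup-map (index x) Fin.suc v

  preserving : Vec (Fin n) (size P) → ℕ
  preserving v = 𝟙[ isωOrderPreserving? P (toMap P v) ]

  #-∑ : ∀ n → #ωOrderPreserving P n ≡ ∑[ vectors (allFin n) (size P) ] preserving
  #-∑ n = length-filter-∑ (λ v → isωOrderPreserving? P (toMap P v)) (vectors (allFin n) (size P))

-- The difference equation for the counts. It includes `n = 0`, so the counts are determined by
-- their value at 0.
#-suc : ∀ P n → #ωOrderPreserving P (suc n)
              ≡ #ωOrderPreserving P n
                ℕ.+ ∑[ nonemptyNaturalIdeals P ] (λ S → #ωOrderPreserving (P ∖ S) n)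
#-suc P n = begin
  #ωOrderPreserving P (suc n)
    ≡⟨ #-∑ P (suc n) ⟩
  ∑[ vectors (allFin (suc n)) (size P) ] (preserving P)
    ≡⟨ ∑-merge (size P) n (preserving P) ⟩
  ∑[ subsets (size P) ] f
    ≡⟨ ∑-subsets-⊥ f g f≡g g⊥ ⟩
  f ⊥ ℕ.+ ∑[ subsets (size P) ] g
    -- `nonemptyNaturalIdeals` filters the very list `subsets (size P)`, so its sum is a sum over
    -- all subsets weighted by the decision in `g`.
    ≡⟨ cong₂ ℕ._+_ f⊥ (sym (∑-filter (nonemptyNaturalIdeal? P)
                         (λ S → #ωOrderPreserving (P ∖ S) n) (subsets (size P)))) ⟩
  #ωOrderPreserving P n ℕ.+ ∑[ nonemptyNaturalIdeals P ] (λ S → #ωOrderPreserving (P ∖ S) n)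
    ∎
  where
  open ≡-Reasoning

  f g : Subset (size P) → ℕ
  f S = ∑[ vectors (allFin n) ∣ ∁ S ∣ ] (preserving P ∘ merge S)
  g S = if does (nonemptyNaturalIdeal? P S) then #ωOrderPreserving (P ∖ S) n else 0

  f≡g : ∀ S → Nonempty S → f S ≡ g S
  f≡g S ne = by-cases (nonemptyNaturalIdeal? P S)
    where
    ws : List (Vec (Fin n) ∣ ∁ S ∣)
    ws = vectors (allFin n) ∣ ∁ S ∣

    by-cases : (d : Dec (NonemptyNaturalIdeal P S)) →
               f S ≡ (if does d then #ωOrderPreserving (P ∖ S) n else 0)
    by-cases (yes (_ , S∈𝓘)) = begin
      ∑[ ws ] (preserving P ∘ merge S)  ≡⟨ ∑-cong {f = preserving P ∘ merge S} {preserving (P ∖ S)} restrict ws ⟩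
      ∑[ ws ] (preserving (P ∖ S))      ≡⟨ sym (#-∑ (P ∖ S) n) ⟩
      #ωOrderPreserving (P ∖ S) n       ∎
      where
      restrict : ∀ w → preserving P (merge S w) ≡ preserving (P ∖ S) w
      restrict w = 𝟙-cong
        (mk⇔ (proj₂ ∘ Equivalence.to (preserving-merge P S w))
             (λ h → Equivalence.from (preserving-merge P S w) (S∈𝓘 , h)))
        (isωOrderPreserving? P (toMap P (merge S w)))
        (isωOrderPreserving? (P ∖ S) (toMap (P ∖ S) w))
    -- Here `S` is non-empty, so it fails to be a natural ideal, and no preserving map has `S` as
    -- its fibre over zero.
    by-cases (no ¬S) = trans (∑-cong {f = preserving P ∘ merge S} {λ _ → 0} none ws) (∑-zero ws)
      where
      none : ∀ w → preserving P (merge S w) ≡ 0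
      none w = cong (if_then 1 else 0) (dec-false (isωOrderPreserving? P (toMap P (merge S w)))
        (λ h → ¬S (ne , proj₁ (Equivalence.to (preserving-merge P S w) h))))

  g⊥ : g ⊥ ≡ 0
  g⊥ = cong (if_then #ωOrderPreserving (P ∖ ⊥) n else 0)
    (dec-false (nonemptyNaturalIdeal? P ⊥) λ ((_ , i∈⊥) , _) → ∉⊥ i∈⊥)

  f⊥ : f ⊥ ≡ #ωOrderPreserving P n
  f⊥ = begin
    f ⊥
      ≡⟨ ∑-merge-⊥ (size P) n (preserving P) ⟩
    ∑[ vectors (allFin n) (size P) ] (preserving P ∘ Vec.map Fin.suc)
      ≡⟨ ∑-cong {f = preserving P ∘ Vec.map Fin.suc} {preserving P} unshift (vectors (allFin n) (size P)) ⟩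
    ∑[ vectors (allFin n) (size P) ] (preserving P)
      ≡⟨ sym (#-∑ P n) ⟩
    #ωOrderPreserving P n
      ∎
    where
    unshift : ∀ v → preserving P (Vec.map Fin.suc v) ≡ preserving P v
    unshift v = 𝟙-cong (preserving-map-suc P v)
      (isωOrderPreserving? P (toMap P (Vec.map Fin.suc v))) (isωOrderPreserving? P (toMap P v))

-- Initial values of the counts

vectors-[] : ∀ m → m ≢ 0 → vectors {A} [] m ≡ []
vectors-[] zero    m≢0 = contradiction refl m≢0
vectors-[] (suc m) _   = refl

#-zero : ∀ P → size P ≢ 0 → #ωOrderPreserving P 0 ≡ 0
#-zero P P≢∅ = cong (length ∘ filter (λ v → isωOrderPreserving? P (toMap P v)))
  (vectors-[] (size P) P≢∅)

-- Stated for a variable `m`, so that the equation can be matched with `refl`; `size P` itself is no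
-- variable.
∑-vectors-zero : ∀ (as : List A) m → m ≡ 0 → (f : Vec A m → ℕ) → (∀ v → f v ≡ 1) →
                 ∑[ vectors as m ] f ≡ 1
∑-vectors-zero as _ refl f f≡1 = cong (ℕ._+ 0) (f≡1 [])

#-empty : ∀ P → size P ≡ 0 → ∀ n → #ωOrderPreserving P n ≡ 1
#-empty P P≡∅ n = trans (#-∑ P n) (∑-vectors-zero (allFin n) (size P) P≡∅ (preserving P) λ v →
  cong (if_then 1 else 0) (dec-true (isωOrderPreserving? P (toMap P v))
    ((λ x → contradiction x empty) , (λ x → contradiction x empty))))
  where
  empty : LabeledPoset.Carrier P → Empty
  empty x with () ← subst Fin P≡∅ (LabeledPoset.index P x)

-- Evaluating Ψ

ι-+ : ∀ m n → ι (m ℕ.+ n) ≡ ι m + ι n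
ι-+ zero    n = sym (ℚ.+-identityˡ (ι n))
ι-+ (suc m) n = begin
  ι (suc (m ℕ.+ n))    ≡⟨ ι-suc (m ℕ.+ n) ⟩
  ι (m ℕ.+ n) + 1ℚ     ≡⟨ cong (_+ 1ℚ) (ι-+ m n) ⟩
  ι m + ι n + 1ℚ       ≡⟨ solve 2 (λ u v → u :+ v :+ con 1ℚ := u :+ con 1ℚ :+ v) refl (ι m) (ι n) ⟩
  ι m + 1ℚ + ι n       ≡⟨ cong (_+ ι n) (sym (ι-suc m)) ⟩
  ι (suc m) + ι n      ∎
  where
  open ≡-Reasoning
  open +-*-Solver

-- The agreement is demanded only on the entries of the list, since the induction hypothesis covers
-- `P ∖ S` only for non-empty `S`.
eval-∑ : (F : A → ℚ[t]) (c : A → ℕ) (x : ℚ) {xs : List A} →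
         All (λ a → eval (F a) x ≡ ι (c a)) xs → eval (∑ (map F xs)) x ≡ ι (∑[ xs ] c)
eval-∑ F c x []                        = refl
eval-∑ F c x {a ∷ xs} (eq ∷ eqs) = begin
  eval (F a ⊕ ∑ (map F xs)) x           ≡⟨ eval-⊕ (F a) (∑ (map F xs)) x ⟩
  eval (F a) x + eval (∑ (map F xs)) x  ≡⟨ cong₂ _+_ eq (eval-∑ F c x eqs) ⟩
  ι (c a) + ι (∑[ xs ] c)               ≡⟨ sym (ι-+ (c a) (∑[ xs ] c)) ⟩
  ι (c a ℕ.+ ∑[ xs ] c)                 ∎
  where open ≡-Reasoning

eval-Δ⁻¹-suc : ∀ f n → eval (Δ⁻¹ f) (ι (suc n)) ≡ eval (Δ⁻¹ f) (ι n) + eval f (ι n)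
eval-Δ⁻¹-suc f n = begin
  eval F (ι (suc n))                               ≡⟨ cong (eval F) (ι-suc n) ⟩
  eval F (x + 1ℚ)                                  ≡⟨ solve 2 (λ u v → v := u :+ (v :- u)) refl (eval F x) (eval F (x + 1ℚ)) ⟩
  eval F x + (eval F (x + 1ℚ) - eval F x)          ≡⟨ cong (eval F x +_) (sym (eval-Δ F x)) ⟩
  eval F x + eval (Δ F) x                          ≡⟨ cong (eval F x +_) (eval-cong {Δ F} {f} (Δ-Δ⁻¹ f) x) ⟩
  eval F x + eval f x                              ∎
  where
  open ≡-Reasoning
  open +-*-Solver
  F = Δ⁻¹ f
  x = ι n

∣∁S∣<n : (S : Subset n) → Nonempty S → ∣ ∁ S ∣ ℕ.< n
∣∁S∣<n {n} S (i , i∈S) = subst (∣ ∁ S ∣ ℕ.<_) (∣⊤∣≡n n)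
  -- The index `i` of `S` witnesses that the inclusion of `∁ S` in `⊤` is proper.
  (p⊂q⇒∣p∣<∣q∣ (⊆-max (∁ S) , i , ∈⊤ , x∈p⇒x∉∁p i∈S))

-- Stronger than `IsOrderPolynomial` by the case `n = 0`, from which the induction on `n` starts.
EvalΨ : LabeledPoset → Set
EvalΨ P = ∀ n → eval (Ψ P) (ι n) ≡ ι (#ωOrderPreserving P n)

eval-Ψ-empty : ∀ P → size P ≡ 0 → EvalΨ P
eval-Ψ-empty P P≡∅ n = begin
  eval (Ψ P) (ι n)           ≡⟨ cong (λ f → eval f (ι n)) (Ψ-empty P P≡∅) ⟩
  eval one (ι n)             ≡⟨ solve 1 (λ x → con 1ℚ :+ x :* con 0ℚ := con 1ℚ) refl (ι n) ⟩
  ι 1                        ≡⟨ cong ι (sym (#-empty P P≡∅ n)) ⟩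
  ι (#ωOrderPreserving P n)  ∎
  where
  open ≡-Reasoning
  open +-*-Solver

eval-Ψ-nonempty : ∀ P → size P ≢ 0 → (∀ S → Nonempty S → EvalΨ (P ∖ S)) → EvalΨ P
eval-Ψ-nonempty P P≢∅ rec n = trans (cong (λ f → eval f (ι n)) (Ψ-nonempty P P≢∅)) (agree n)
  where
  open ≡-Reasoning

  h : ℚ[t]
  h = ∑ (map (λ S → Ψ (P ∖ S)) (nonemptyNaturalIdeals P))

  c : ℕ → ℕ
  c n = ∑[ nonemptyNaturalIdeals P ] (λ S → #ωOrderPreserving (P ∖ S) n)

  eval-h : ∀ n → eval h (ι n) ≡ ι (c n)
  eval-h n = eval-∑ (λ S → Ψ (P ∖ S)) (λ S → #ωOrderPreserving (P ∖ S) n) (ι n)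
    (All.map (λ {S} (ne , _) → rec S ne n) (all-filter (nonemptyNaturalIdeal? P) (subsets (size P))))

  agree : ∀ n → eval (Δ⁻¹ h) (ι n) ≡ ι (#ωOrderPreserving P n)
  agree zero    = trans (Δ⁻¹-zero h) (cong ι (sym (#-zero P P≢∅)))
  agree (suc n) = begin
    eval (Δ⁻¹ h) (ι (suc n))                  ≡⟨ eval-Δ⁻¹-suc h n ⟩
    eval (Δ⁻¹ h) (ι n) + eval h (ι n)         ≡⟨ cong₂ _+_ (agree n) (eval-h n) ⟩
    ι (#ωOrderPreserving P n) + ι (c n)       ≡⟨ sym (ι-+ (#ωOrderPreserving P n) (c n)) ⟩
    ι (#ωOrderPreserving P n ℕ.+ c n)         ≡⟨ cong ι (sym (#-suc P n)) ⟩
    ι (#ωOrderPreserving P (suc n))           ∎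

eval-Ψ : ∀ P → EvalΨ P
eval-Ψ P = <-rec (λ k → ∀ P → size P ≡ k → EvalΨ P) step (size P) P refl
  where
  step : ∀ k → (∀ {j} → j ℕ.< k → ∀ P → size P ≡ j → EvalΨ P) → ∀ P → size P ≡ k → EvalΨ P
  step _ rec P refl = by-cases (size P ℕ.≟ 0)
    where
    by-cases : Dec (size P ≡ 0) → EvalΨ P
    by-cases (yes P≡∅) = eval-Ψ-empty P P≡∅
    -- The size of `P ∖ S` is `∣ ∁ S ∣` by definition, hence `refl`.
    by-cases (no P≢∅)  = eval-Ψ-nonempty P P≢∅ λ S ne → rec (∣∁S∣<n S ne) (P ∖ S) refl

-- Uniqueness of the order polynomial, and the theorem

IsOrderPolynomial-unique : ∀ P f g → IsOrderPolynomial P f → IsOrderPolynomial P g → f ≈ g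
-- The values are prescribed from `n = 1` on, so the sequence of points starts at `1ℚ`.
IsOrderPolynomial-unique P f g hf hg = eval-injective 1ℚ f g λ n →
  subst (λ x → eval f x ≡ eval g x) (ι-+ 1 n)
    (trans (hf (suc n) (s≤s z≤n)) (sym (hg (suc n) (s≤s z≤n))))

proposition3p4 : (P : LabeledPoset) →
    ∃! _≈_ (IsOrderPolynomial P) × (∀ Ω → IsOrderPolynomial P Ω → Ψ P ≈ Ω)
-- `Ψ P` itself witnesses the existence of the order polynomial; uniqueness then also gives the
-- equality of the two.
proposition3p4 P = (Ψ P , isΩ , λ {Ω} → unique Ω) , unique
  where
  isΩ : IsOrderPolynomial P (Ψ P)
  isΩ n _ = eval-Ψ P n

  unique : ∀ Ω → IsOrderPolynomial P Ω → Ψ P ≈ Ω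
  unique Ω = IsOrderPolynomial-unique P (Ψ P) Ω isΩ
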